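{- Let $\psi_\omega$ and $\psi_2$ be the Fraïssé limits of the class of finite pseudotrees and of the class of finite binary pseudotrees respectively, and let $\mathrm C$ be the 2-element pseudotree that is a chain $a<b$. Then $\mathrm d(\psi_2 : \mathrm C) \geq 7$ and $\mathrm d(\psi_\omega : \mathrm C) \geq 8$.
   Context: A pseudotree is a structure $T$ with a (reflexive, antisymmetric, transitive) order relation $\leq$ and a binary function $\wedge$ such that $\sup\{x \in T : x \leq a,\ x \leq b\} = a \wedge b$ for all $a,b \in T$ (in particular this supremum exists), and such that for each $a \in T$ the set $\{x \in T : x \leq a\}$ is linearly ordered by $\leq$. A pseudotree $T$ is binary if for every $a \in T$ and $x,y,z > a$ it is not the case that $a = x\wedge y = x \wedge z = y \wedge z$. Finite pseudotrees, and finite binary pseudotrees, with embeddings respecting $\leq$ and $\wedge$, form Fraïssé classes, so the Fraïssé limits $\psi_\omega$ and $\psi_2$ exist. For structures $A, B$, $\binom{B}{A}$ is the set of all substructures of $B$ isomorphic to $A$. A natural number $\ell$ is identified with $\{0,\dots,\ell-1\}$. For $\ell \in \omega$ write $B \to (B)^A_\ell$ if for every function $c\colon \binom{B}{A} \to \ell$ there exists $C \in \binom{B}{B}$ such that the image $c\left[\binom{C}{A}\right]$ is not equal to $\ell$ (i.e. some color is omitted). The big Ramsey degree $\mathrm d(B : A)$ of $A$ in $B$ is the smallest $\ell\in\omega$ for which $B \to (B)^A_{\ell+1}$, and $\mathrm d(B:A) = \infty$ if no such $\ell$ exists. -}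

module Defs where

open import Data.Bool.Base as Bool using (Bool; true; false; b≤b)
import Data.Bool.Properties as Bool
open import Data.Fin.Base using (Fin)
open import Data.List.Base using (List)
open import Data.Nat.Base as ℕ using (ℕ; suc)
open import Data.Product.Base using (Σ-syntax; ∃; _×_; _,_; proj₁; proj₂)
open import Data.Sum.Base using (_⊎_)
open import Function.Base using (_on_)
open import Function.Bundles using (Func; Inverse; RightInverse; _⇔_)
open import Level using (0ℓ) renaming (suc to lsuc)
open import Relation.Binary.Bundles using (Setoid)
open import Relation.Binary.Core using (Rel)
open import Relation.Binary.Definitions using (_Respects_; _Respects₂_)
open import Relation.Binary.Morphism.Structures using (IsOrderMonomorphism; IsOrderIsomorphism)
open import Relation.Binary.PropositionalEquality as ≡ using (_≡_)
open import Relation.Binary.Structures using (IsEquivalence; IsPartialOrder)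
open import Relation.Nullary.Construct.Add.Supremum using (_⁺; [_]; ⊤⁺) public
open import Relation.Nullary.Negation.Core using (¬_)
open import Relation.Unary using (Pred; _⊆_; _≐_; U)
open import Relation.Unary.Properties using (≐-refl; ≐-sym; ≐-trans)
open import Algebra.Core using (Op₂)
open import Algebra.Definitions using (Congruent₂)
import Algebra.Morphism.Definitions as Morphism
import Data.List.Membership.Setoid as Membership
import Relation.Binary.Construct.Add.Supremum.NonStrict ℕ._≤_ as Sup
import Relation.Binary.Construct.NonStrictToStrict as ToStrict

open Sup using (_≤⁺_) public

-- First-order structures with one binary relation and one binary operation.
-- Equality is a setoid equality so that the carrier of a substructure can be
-- a Σ-type over a proof-relevant predicate.

record Structure : Set₁ where
  infix  4 _≈_ _≤_
  infixr 7 _∧_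
  field
    Carrier       : Set
    _≈_           : Rel Carrier 0ℓ
    _≤_           : Rel Carrier 0ℓ
    _∧_           : Op₂ Carrier
    isEquivalence : IsEquivalence _≈_
    ≤-resp-≈      : _≤_ Respects₂ _≈_
    ∧-cong        : Congruent₂ _≈_ _∧_

  setoid : Setoid 0ℓ 0ℓ
  setoid = record { isEquivalence = isEquivalence }

  open IsEquivalence isEquivalence public
  open ToStrict _≈_ _≤_ public using (_<_)

∣_∣ : Structure → Set
∣_∣ = Structure.Carrier

module _ (A B : Structure) where
  private
    module A = Structure A
    module B = Structure B
  open Morphism A.Carrier B.Carrier B._≈_ using (Homomorphic₂)

  infix 4 _↪_ _≅_

  record _↪_ : Set where
    field
      to                  : A.Carrier → B.Carrier
      isOrderMonomorphism : IsOrderMonomorphism A._≈_ B._≈_ A._≤_ B._≤_ to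
      ∧-homo              : Homomorphic₂ to A._∧_ B._∧_
    open IsOrderMonomorphism isOrderMonomorphism public

  record _≅_ : Set where
    field
      to                 : A.Carrier → B.Carrier
      isOrderIsomorphism : IsOrderIsomorphism A._≈_ B._≈_ A._≤_ B._≤_ to
      ∧-homo             : Homomorphic₂ to A._∧_ B._∧_
    open IsOrderIsomorphism isOrderIsomorphism public

record Substructure (B : Structure) : Set₁ where
  open Structure B
  field
    Member : Pred Carrier 0ℓ
    resp   : Member Respects _≈_
    closed : ∀ {x y} → Member x → Member y → Member (x ∧ y)

  structure : Structure
  structure = record
    { Carrier       = ∃ Member
    ; _≈_           = _≈_ on proj₁
    ; _≤_           = _≤_ on proj₁
    ; _∧_           = λ (x , p) (y , q) → x ∧ y , closed p q
    ; isEquivalence = record { refl = refl ; sym = sym ; trans = trans }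
    ; ≤-resp-≈      = (λ p → proj₁ ≤-resp-≈ p) , (λ p → proj₂ ≤-resp-≈ p)
    ; ∧-cong        = ∧-cong
    }

open Substructure public using (Member; structure)

module _ (A : Structure) where
  open Structure A
  open Membership setoid using (_∈_)

  data Generated (xs : List Carrier) : Pred Carrier 0ℓ where
    gen  : ∀ {x} → x ∈ xs → Generated xs x
    meet : ∀ {x y z} → Generated xs x → Generated xs y → z ≈ x ∧ y → Generated xs z

  FinitelyGenerated : Set
  FinitelyGenerated = Σ[ xs ∈ List Carrier ] (∀ a → Generated xs a)

  Finite : Set
  Finite = Σ[ n ∈ ℕ ] Inverse (≡.setoid (Fin n)) setoid

  -- A retract of ℕ: classically, a nonempty countable set.  Constructively this
  -- says that the elements can be enumerated and that _≈_ is decidable.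
  Countable : Set
  Countable = RightInverse setoid (≡.setoid ℕ)

  IsSup : Pred Carrier 0ℓ → Pred Carrier 0ℓ
  IsSup P s = (∀ {x} → P x → x ≤ s) × (∀ u → (∀ {x} → P x → x ≤ u) → s ≤ u)

record IsPseudotree (T : Structure) : Set where
  open Structure T
  field
    isPartialOrder : IsPartialOrder _≈_ _≤_
    ∧-sup          : ∀ a b → IsSup T (λ x → x ≤ a × x ≤ b) (a ∧ b)
    down-linear    : ∀ a {x y} → x ≤ a → y ≤ a → x ≤ y ⊎ y ≤ x

IsBinary : Structure → Set
IsBinary T = ∀ a x y z → a < x → a < y → a < z →
             ¬ (a ≈ x ∧ y × a ≈ x ∧ z × a ≈ y ∧ z)
  where open Structure T

FinitePseudotree : Structure → Set
FinitePseudotree T = Finite T × IsPseudotree T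

FiniteBinaryPseudotree : Structure → Set
FiniteBinaryPseudotree T = Finite T × IsPseudotree T × IsBinary T

-- The age, as an isomorphism-closed class.
Age : Structure → Structure → Set
Age M A = FinitelyGenerated A × (A ↪ M)

Ultrahomogeneous : Structure → Set₁
Ultrahomogeneous M =
  (S T : Substructure M) → FinitelyGenerated (structure S) →
  (f : structure S ≅ structure T) →
  Σ[ g ∈ M ≅ M ] (∀ s → _≅_.to g (proj₁ s) ≈ proj₁ (_≅_.to f s))
  where open Structure M

record IsFraïsséLimit (K : Structure → Set) (M : Structure) : Set₁ where
  field
    countable        : Countable M
    ultrahomogeneous : Ultrahomogeneous M
    age              : ∀ A → Age M A ⇔ K A

-- The elements of binom(B, A).  Two of them are equal when they are the same
-- substructure; the choice of isomorphism is irrelevant.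

record Copy (A B : Structure) : Set₁ where
  field
    sub : Substructure B
    iso : A ≅ structure sub

  ⟨_⟩ : Pred ∣ B ∣ 0ℓ
  ⟨_⟩ = Member sub

open Copy public using (⟨_⟩)

Copies : (A B : Structure) → Setoid (lsuc 0ℓ) 0ℓ
Copies A B = record
  { Carrier       = Copy A B
  ; _≈_           = λ D E → ⟨ D ⟩ ≐ ⟨ E ⟩
  ; isEquivalence = record { refl = ≐-refl ; sym = ≐-sym ; trans = ≐-trans }
  }

Colouring : (A B : Structure) → ℕ → Set₁
Colouring A B ℓ = Func (Copies A B) (≡.setoid (Fin ℓ))

-- The set c[binom(C, A)] of colours: a substructure of C is a substructure of
-- B contained in C.
image : ∀ {A B ℓ} → Colouring A B ℓ → Copy B B → Pred (Fin ℓ) (lsuc 0ℓ)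
image {A} {B} c C k = Σ[ D ∈ Copy A B ] (⟨ D ⟩ ⊆ ⟨ C ⟩ × Func.to c D ≡ k)

-- B ⟶⟨ A ⟩ ℓ is the partition relation B → (B)^A_ℓ.
infix 4 _⟶⟨_⟩_
_⟶⟨_⟩_ : Structure → Structure → ℕ → Set₁
B ⟶⟨ A ⟩ ℓ = (c : Colouring A B ℓ) → Σ[ C ∈ Copy B B ] ¬ (image c C ≐ U)

-- IsBigRamseyDegree B A d says that d(B : A) = d, where ⊤⁺ is ∞.
IsBigRamseyDegree : Structure → Structure → ℕ ⁺ → Set₁
IsBigRamseyDegree B A [ ℓ ] = (B ⟶⟨ A ⟩ suc ℓ) × (∀ m → B ⟶⟨ A ⟩ suc m → ℓ ℕ.≤ m)
IsBigRamseyDegree B A ⊤⁺    = ∀ ℓ → ¬ (B ⟶⟨ A ⟩ suc ℓ)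

-- The two-element chain false < true.
Chain : Structure
Chain = record
  { Carrier       = Bool
  ; _≈_           = _≡_
  ; _≤_           = Bool._≤_
  ; _∧_           = Bool._∧_
  ; isEquivalence = ≡.isEquivalence
  ; ≤-resp-≈      = ≡.resp₂ Bool._≤_
  ; ∧-cong        = ≡.cong₂ Bool._∧_
  }

Chain-isPseudotree : IsPseudotree Chain
Chain-isPseudotree = record
  { isPartialOrder = Bool.≤-isPartialOrder
  ; ∧-sup          = λ a b → upper a b , least a b
  ; down-linear    = λ _ {x} {y} _ _ → Bool.≤-total x y
  }
  where
  upper : ∀ a b {x} → x Bool.≤ a × x Bool.≤ b → x Bool.≤ a Bool.∧ b
  upper false _ (p , _) = p
  upper true  _ (_ , q) = q

  least : ∀ a b u → (∀ {x} → x Bool.≤ a × x Bool.≤ b → x Bool.≤ u) → a Bool.∧ b Bool.≤ u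
  least false b u h = h (b≤b , Bool.≤-minimum b)
  least true  b u h = h (Bool.≤-maximum b , b≤b)

{-# OPTIONS --safe #-}
module Submission where

-- Enumerate the limit.  For a < b let x, the apex of a, be the element of least index
-- among those ≥ a, let c = x ∧ b be the point where b branches off from x, and let the
-- birth of the cone of b above c be the least index of an element of that cone.  If b has
-- the same apex as a, compare the indices of a and b (2 colours); if c = a, use one colour;
-- and if a < c, locate the index of a among, in this order, the index of c, the birth of
-- the cone, the index of the apex of b and the index of b (5 colours).
--
-- In any copy, pigeonhole gives u < v with the same apex x; elements of the copy between
-- u and v then have apex x too, and x separates them from everything branching off from
-- v.  Each colour is found by choosing a and b in the right order: the relevant index is
-- unbounded while b still varies over the copy and a is fixed, or the other way round.
-- That the birth can exceed the indices of both a and c requires infinitely many cones of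
-- the copy above c.  In ψ₂ there are only two, whence one colour fewer.

open import Defs
open import Data.Product.Base using (_×_)

open import Data.Bool.Base using (true; false; if_then_else_; b≤b; f≤t)
open import Data.Bool.Properties using (≤-minimum; ≤-maximum)
open import Data.Fin.Base as Fin using (Fin; zero; suc; toℕ; fromℕ<)
import Data.Fin.Properties as Fin
open import Data.List.Base using (List; []; _∷_)
open import Data.List.Relation.Unary.Any using (here; there)
open import Data.Nat.Base using (ℕ; zero; suc; _⊓_; _⊔_; s≤s; z≤n)
import Data.Nat.Base as ℕ
import Data.Nat.Properties as ℕ
open import Data.Product.Base using (Σ-syntax; ∃; ∃₂; _,_; proj₁; proj₂)
open import Data.Sum.Base using (_⊎_; inj₁; inj₂; [_,_]′)
open import Data.Unit.Base using (tt)
open import Function.Base using (_∘_)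
open import Function.Bundles using (RightInverse; Equivalence)
open import Function.Construct.Identity using (↔-id)
open import Level using (0ℓ)
open import Relation.Binary.Construct.Add.Supremum.NonStrict ℕ._≤_ using ([_]; _≤⊤⁺)
open import Relation.Binary.Definitions using (Transitive) renaming (Decidable to Decidable₂)
open import Relation.Binary.PropositionalEquality as ≡ using (_≡_; _≢_)
open import Relation.Binary.Structures using (IsPartialOrder)
open import Relation.Nullary.Decidable.Core using (Dec; yes; no; does; map′; _→-dec_)
open import Relation.Nullary.Negation.Core using (¬_; contradiction)
open import Relation.Unary using (Pred; Decidable; _≐_)

-- Conditionals, least witnesses and the pigeonhole principle.

if-yes : ∀ {P A : Set} {x y : A} (d : Dec P) → P → (if does d then x else y) ≡ x
if-yes (yes _) _ = ≡.refl
if-yes (no ¬p) p = contradiction p ¬p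

if-no : ∀ {P A : Set} {x y : A} (d : Dec P) → ¬ P → (if does d then x else y) ≡ y
if-no (yes p) ¬p = contradiction p ¬p
if-no (no _)  _  = ≡.refl

Least : Pred ℕ 0ℓ → Pred ℕ 0ℓ
Least P m = P m × (∀ {n} → P n → m ℕ.≤ n)

abstract
  least : ∀ {P : Pred ℕ 0ℓ} → Decidable P → ∀ n → P n → ∃ (Least P)
  least P? n p with P? 0
  ... | yes p₀ = 0 , p₀ , λ _ → z≤n
  least P? zero    p | no ¬p₀ = contradiction p ¬p₀
  least P? (suc n) p | no ¬p₀ with m , pₘ , m≤ ← least (P? ∘ suc) n p =
    suc m , pₘ , λ { {zero} p₀ → contradiction p₀ ¬p₀ ; {suc k} pₖ → s≤s (m≤ pₖ) }

bounded-collision : ∀ N (f : Fin (2 ℕ.+ N) → ℕ) → (∀ i → f i ℕ.≤ N) →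
                    ∃₂ λ i j → i Fin.< j × f i ≡ f j
bounded-collision N f f≤N
  with i , j , i<j , eq ← Fin.pigeonhole (ℕ.n<1+n (suc N)) (λ i → fromℕ< (s≤s (f≤N i)))
  = i , j , i<j , Fin.fromℕ<-injective _ _ _ _ eq

-- The search over finitely many arguments is decidable, and `2 + N` values that are all at most `N`
-- would collide. This turns the unboundedness of an injective sequence into a witness; every late
-- index, cover or birth below comes from here.
injective-exceeds : ∀ N (f : Fin (2 ℕ.+ N) → ℕ) → (∀ {i j} → i Fin.< j → f i ≢ f j) →
                    ∃ λ i → N ℕ.< f i
injective-exceeds N f inj with Fin.any? (λ i → N ℕ.<? f i)
... | yes found = found
... | no none
  with i , j , i<j , eq ← bounded-collision N f (λ i → ℕ.≮⇒≥ (λ N<fi → none (i , N<fi)))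
  = contradiction eq (inj i<j)

-- Meets and branching in a pseudotree.

module PseudotreeProperties {T : Structure} (isPseudotree : IsPseudotree T) where
  open Structure T
  open IsPseudotree isPseudotree public
  open IsPartialOrder isPartialOrder public
    using (antisym) renaming (reflexive to ≤-reflexive; refl to ≤-refl; trans to ≤-trans)

  x∧y≤x : ∀ x y → x ∧ y ≤ x
  x∧y≤x x y = proj₂ (∧-sup x y) x proj₁

  x∧y≤y : ∀ x y → x ∧ y ≤ y
  x∧y≤y x y = proj₂ (∧-sup x y) y proj₂

  ∧-greatest : ∀ {x y z} → z ≤ x → z ≤ y → z ≤ x ∧ y
  ∧-greatest z≤x z≤y = proj₁ (∧-sup _ _) (z≤x , z≤y)

  ∧-comm : ∀ x y → x ∧ y ≈ y ∧ x
  ∧-comm x y = antisym (∧-greatest (x∧y≤y x y) (x∧y≤x x y)) (∧-greatest (x∧y≤y y x) (x∧y≤x y x))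

  x≤y⇒x∧y≈x : ∀ {x y} → x ≤ y → x ∧ y ≈ x
  x≤y⇒x∧y≈x x≤y = antisym (x∧y≤x _ _) (∧-greatest ≤-refl x≤y)

  <⇒≱ : ∀ {x y} → x < y → ¬ y ≤ x
  <⇒≱ (x≤y , x≉y) y≤x = x≉y (antisym x≤y y≤x)

  <-≤-trans : ∀ {x y z} → x < y → y ≤ z → x < z
  <-≤-trans (x≤y , x≉y) y≤z =
    ≤-trans x≤y y≤z , λ x≈z → x≉y (antisym x≤y (≤-trans y≤z (≤-reflexive (sym x≈z))))

  <-trans : ∀ {x y z} → x < y → y < z → x < z
  <-trans x<y y<z = <-≤-trans x<y (proj₁ y<z)

  -- `x ∧ b` and `v` both lie below `x`, hence are comparable, and `v ≤ x ∧ b` would force `v ≤ b`.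
  -- Thus an apex `x` may be replaced by a smaller `v` when the branching point of `b` is computed.
  ∧-extendˡ : ∀ {v x b} → ¬ v ≤ b → v ≤ x → x ∧ b ≈ v ∧ b
  ∧-extendˡ {v} {x} {b} v≰b v≤x with down-linear x (x∧y≤x x b) v≤x
  ... | inj₁ x∧b≤v = antisym (∧-greatest x∧b≤v (x∧y≤y x b))
                             (∧-greatest (≤-trans (x∧y≤x v b) v≤x) (x∧y≤y v b))
  ... | inj₂ v≤x∧b = contradiction (≤-trans v≤x∧b (x∧y≤y x b)) v≰b

  infix 4 _splits_at_
  _splits_at_ : ∣ T ∣ → ∣ T ∣ → ∣ T ∣ → Set
  b splits v at c = c < b × v ∧ b ≈ c

  splits⇒≰ : ∀ {v c b} → b splits v at c → ¬ b ≤ v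
  splits⇒≰ (c<b , v∧b≈c) b≤v = <⇒≱ c<b (≤-trans (∧-greatest b≤v ≤-refl) (≤-reflexive v∧b≈c))

  splits⇒≱ : ∀ {v c b} → c < v → b splits v at c → ¬ v ≤ b
  splits⇒≱ c<v (_ , v∧b≈c) v≤b = <⇒≱ c<v (≤-trans (∧-greatest ≤-refl v≤b) (≤-reflexive v∧b≈c))

  splits-within : ∀ {v c b w} → c < w → w ≤ b → b splits v at c → w splits v at c
  splits-within {v} {c} {b} {w} c<w w≤b (_ , v∧b≈c) =
    c<w , antisym (≤-trans (∧-greatest (x∧y≤x v w) (≤-trans (x∧y≤y v w) w≤b)) (≤-reflexive v∧b≈c))
                  (∧-greatest (≤-trans (≤-reflexive (sym v∧b≈c)) (x∧y≤x v b)) (proj₁ c<w))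

  -- As `w` is not below `v`, `∧-extendˡ` applies to `w ≤ b`, so `v` meets `b` where it meets `w`.
  splits-beyond : ∀ {v c w b} → w splits v at c → w ≤ b → b splits v at c
  splits-beyond {v} {c} {w} {b} s@(c<w , v∧w≈c) w≤b = <-≤-trans c<w w≤b ,
    trans (∧-comm v b) (trans (∧-extendˡ (splits⇒≰ s) w≤b) (trans (∧-comm w v) v∧w≈c))

-- What the first seven colours ask of the limit; `HasFans` is added for the eighth. The conclusion
-- of `split` is that `b` splits `v` at `c`, spelled out because `_splits_at_` presupposes a proof
-- of `IsPseudotree`.
record IsRich (T : Structure) : Set where
  open Structure T
  field
    bottom top : Carrier
    bottom<top : bottom < top
    between    : ∀ {u v} → u < v → ∃ λ w → u < w × w < v
    split      : ∀ {c v} → c < v → ∃ λ b → c < b × v ∧ b ≈ c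

-- Infinite branching in finite portions: the `b i` lie in distinct cones above `c`, none of them
-- the cone of `v`. Binarity forbids `n = 2`, as `v` would then belong to a third cone.
HasFans : Structure → Set
HasFans T = ∀ {c v} → c < v → ∀ n →
  Σ[ b ∈ (Fin n → Carrier) ] (∀ i → c < b i × v ∧ b i ≈ c) ×
                             (∀ {i j} → i ≢ j → b i ∧ b j ≈ c)
  where open Structure T

-- Embeddings, their images and copies.

module _ {A B : Structure} (φ : A ↪ B) where
  private
    module A = Structure A
    module B = Structure B
    module φ = _↪_ φ

  strict-mono : ∀ {x y} → x A.< y → φ.to x B.< φ.to y
  strict-mono (x≤y , x≉y) = φ.mono x≤y , λ eq → x≉y (φ.injective eq)

  imageSub : Substructure B
  imageSub = record
    { Member = λ z → ∃ λ x → φ.to x B.≈ z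
    ; resp   = λ z≈w (x , p) → x , B.trans p z≈w
    ; closed = λ (x , p) (y , q) → x A.∧ y , B.trans (φ.∧-homo x y) (B.∧-cong p q)
    }

  image-iso : A ≅ structure imageSub
  image-iso = record
    { to = λ x → φ.to x , x , B.refl
    ; isOrderIsomorphism = record
      { isOrderMonomorphism = record
        { isOrderHomomorphism = record { cong = φ.cong ; mono = φ.mono }
        ; injective = φ.injective
        ; cancel    = φ.cancel
        }
      ; surjective = λ (_ , x , p) → x , λ z≈x → B.trans (φ.cong z≈x) p
      }
    ; ∧-homo = φ.∧-homo
    }

-- This is `ψ ∘ φ⁻¹`. A membership proof carries a preimage, so the inverse is read off from it, and
-- injectivity of `φ` makes the result independent of that preimage.
image-≅ : ∀ {A B : Structure} (φ ψ : A ↪ B) → structure (imageSub φ) ≅ structure (imageSub ψ)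
image-≅ {A} {B} φ ψ = record
  { to = λ (_ , x , _) → ψ.to x , x , B.refl
  ; isOrderIsomorphism = record
    { isOrderMonomorphism = record
      { isOrderHomomorphism = record
        { cong = λ { {_ , x , p} {_ , y , q} e → ψ.cong (φ.injective (B.trans p (B.trans e (B.sym q)))) }
        ; mono = λ { {_ , x , p} {_ , y , q} l → ψ.mono (φ.cancel (shift (B.sym p) (B.sym q) l)) }
        }
      ; injective = λ { {_ , x , p} {_ , y , q} e →
                        B.trans (B.sym p) (B.trans (φ.cong (ψ.injective e)) q) }
      ; cancel    = λ { {_ , x , p} {_ , y , q} l → shift p q (φ.mono (ψ.cancel l)) }
      }
    ; surjective = λ (_ , x , p) → (φ.to x , x , B.refl) ,
                     λ { {_ , y , q} e → B.trans (ψ.cong (φ.injective (B.trans q e))) p }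
    }
  ; ∧-homo = λ (_ , x , _) (_ , y , _) → ψ.∧-homo x y
  }
  where
  module B = Structure B
  module φ = _↪_ φ
  module ψ = _↪_ ψ
  shift : ∀ {x x′ y y′} → x B.≈ x′ → y B.≈ y′ → x B.≤ y → x′ B.≤ y′
  shift p q l = proj₁ B.≤-resp-≈ q (proj₂ B.≤-resp-≈ p l)

copy-↪ : ∀ {A B : Structure} → Copy A B → A ↪ B
copy-↪ C = record
  { to = λ x → proj₁ (iso.to x)
  ; isOrderMonomorphism = record
    { isOrderHomomorphism = record { cong = iso.cong ; mono = iso.mono }
    ; injective = iso.injective
    ; cancel    = iso.cancel
    }
  ; ∧-homo = iso.∧-homo
  }
  where module iso = _≅_ (Copy.iso C)

module _ {T : Structure} (isPseudotree : IsPseudotree T) where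
  open Structure T
  open PseudotreeProperties isPseudotree

  chain-↪ : ∀ {a b} → a < b → Chain ↪ T
  chain-↪ {a} {b} a<b = record
    { to = to
    ; isOrderMonomorphism = record
      { isOrderHomomorphism = record { cong = λ { ≡.refl → refl } ; mono = mono }
      ; injective = injective
      ; cancel    = cancel
      }
    ; ∧-homo = ∧-homo
    }
    where
    to = λ x → if x then b else a

    mono : ∀ {x y} → x Data.Bool.Base.≤ y → to x ≤ to y
    mono f≤t = proj₁ a<b
    mono b≤b = ≤-refl

    injective : ∀ {x y} → to x ≈ to y → x ≡ y
    injective {false} {false} _ = ≡.refl
    injective {false} {true}  e = contradiction e (proj₂ a<b)
    injective {true}  {false} e = contradiction (sym e) (proj₂ a<b)
    injective {true}  {true}  _ = ≡.refl

    cancel : ∀ {x y} → to x ≤ to y → x Data.Bool.Base.≤ y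
    cancel {false} {y}     _ = ≤-minimum y
    cancel {true}  {true}  _ = b≤b
    cancel {true}  {false} l = contradiction l (<⇒≱ a<b)

    ∧-homo : ∀ x y → to (x Data.Bool.Base.∧ y) ≈ to x ∧ to y
    ∧-homo false false = sym (x≤y⇒x∧y≈x ≤-refl)
    ∧-homo false true  = sym (x≤y⇒x∧y≈x (proj₁ a<b))
    ∧-homo true  false = sym (trans (∧-comm b a) (x≤y⇒x∧y≈x (proj₁ a<b)))
    ∧-homo true  true  = sym (x≤y⇒x∧y≈x ≤-refl)

-- Brooms: finite pseudotrees to be embedded in the limits.

-- A chain zero < suc zero carrying 2 + n pairwise incomparable leaves.
module _ (n : ℕ) where
  private
    Node = Fin (4 ℕ.+ n)

  data _≼_ : Node → Node → Set where
    root≼ : ∀ {j} → zero ≼ j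
    stem≼ : ∀ {j} → suc zero ≼ suc j
    refl≼ : ∀ {i} → i ≼ i

  _⋏_ : Node → Node → Node
  zero        ⋏ _           = zero
  suc _       ⋏ zero        = zero
  suc zero    ⋏ suc _       = suc zero
  suc (suc _) ⋏ suc zero    = suc zero
  suc (suc i) ⋏ suc (suc j) = if does (i Fin.≟ j) then suc (suc i) else suc zero

  Broom : Structure
  Broom = record
    { Carrier       = Node
    ; _≈_           = _≡_
    ; _≤_           = _≼_
    ; _∧_           = _⋏_
    ; isEquivalence = ≡.isEquivalence
    ; ≤-resp-≈      = ≡.resp₂ _≼_
    ; ∧-cong        = ≡.cong₂ _⋏_
    }

  Broom-finite : Finite Broom
  Broom-finite = 4 ℕ.+ n , ↔-id _

  private
    ≼-trans : Transitive _≼_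
    ≼-trans root≼ _     = root≼
    ≼-trans stem≼ stem≼ = stem≼
    ≼-trans stem≼ refl≼ = stem≼
    ≼-trans refl≼ q     = q

    ≼-antisym : ∀ {i j} → i ≼ j → j ≼ i → i ≡ j
    ≼-antisym root≼ root≼ = ≡.refl
    ≼-antisym root≼ refl≼ = ≡.refl
    ≼-antisym stem≼ stem≼ = ≡.refl
    ≼-antisym stem≼ refl≼ = ≡.refl
    ≼-antisym refl≼ _     = ≡.refl

    ⋏-lowerˡ : ∀ i j → (i ⋏ j) ≼ i
    ⋏-lowerˡ zero        _           = root≼
    ⋏-lowerˡ (suc _)     zero        = root≼
    ⋏-lowerˡ (suc zero)  (suc _)     = refl≼
    ⋏-lowerˡ (suc (suc _)) (suc zero)  = stem≼
    ⋏-lowerˡ (suc (suc i)) (suc (suc j)) with i Fin.≟ j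
    ... | yes _ = refl≼
    ... | no _  = stem≼

    ⋏-lowerʳ : ∀ i j → (i ⋏ j) ≼ j
    ⋏-lowerʳ zero        _           = root≼
    ⋏-lowerʳ (suc _)     zero        = root≼
    ⋏-lowerʳ (suc zero)  (suc _)     = stem≼
    ⋏-lowerʳ (suc (suc _)) (suc zero)  = refl≼
    ⋏-lowerʳ (suc (suc i)) (suc (suc j)) with i Fin.≟ j
    ... | yes ≡.refl = refl≼
    ... | no _       = stem≼

    ⋏-idem : ∀ i → i ⋏ i ≡ i
    ⋏-idem zero          = ≡.refl
    ⋏-idem (suc zero)    = ≡.refl
    ⋏-idem (suc (suc i)) = if-yes (i Fin.≟ i) ≡.refl

    ⋏-greatest : ∀ {i j k} → k ≼ i → k ≼ j → k ≼ (i ⋏ j)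
    ⋏-greatest root≼ _ = root≼
    ⋏-greatest stem≼ q = stem-greatest _ q
      where
      stem-greatest : ∀ {j} i → suc zero ≼ j → suc zero ≼ (suc i ⋏ j)
      stem-greatest zero    stem≼ = stem≼
      stem-greatest zero    refl≼ = stem≼
      stem-greatest (suc i) (stem≼ {zero}) = refl≼
      stem-greatest (suc i) (stem≼ {suc j}) with i Fin.≟ j
      ... | yes _ = stem≼
      ... | no _  = stem≼
      stem-greatest (suc i) refl≼ = refl≼
    ⋏-greatest refl≼ root≼ = root≼
    ⋏-greatest refl≼ stem≼ = stem≼
    ⋏-greatest {i} refl≼ refl≼ = ≡.subst (i ≼_) (≡.sym (⋏-idem i)) refl≼

    ≼-down-linear : ∀ {i j k} → i ≼ k → j ≼ k → i ≼ j ⊎ j ≼ i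
    ≼-down-linear root≼ _     = inj₁ root≼
    ≼-down-linear refl≼ q     = inj₂ q
    ≼-down-linear stem≼ root≼ = inj₂ root≼
    ≼-down-linear stem≼ stem≼ = inj₁ refl≼
    ≼-down-linear stem≼ refl≼ = inj₁ stem≼

  Broom-isPseudotree : IsPseudotree Broom
  Broom-isPseudotree = record
    { isPartialOrder = record
      { isPreorder = record
        { isEquivalence = ≡.isEquivalence
        ; reflexive     = λ { ≡.refl → refl≼ }
        ; trans         = ≼-trans
        }
      ; antisym = ≼-antisym
      }
    ; ∧-sup = λ i j → (λ (p , q) → ⋏-greatest p q) , λ u ub → ub (⋏-lowerˡ i j , ⋏-lowerʳ i j)
    ; down-linear = λ _ → ≼-down-linear
    }

-- Two nodes above the root both lie above the stem, so they never meet in the root. Only two leaves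
-- lie above the stem, so two of `x`, `y`, `z` are the same leaf, which is then their meet. Nothing
-- lies above a leaf.
Broom-isBinary : IsBinary (Broom 0)
Broom-isBinary zero zero _ _ (_ , 0≢x) = contradiction ≡.refl 0≢x
Broom-isBinary zero (suc _) zero _ _ (_ , 0≢y) = contradiction ≡.refl 0≢y
Broom-isBinary zero (suc x) (suc y) _ _ _ _ (eq , _ , _) = root≢ x y eq
  where
  root≢ : ∀ x y → zero ≢ _⋏_ 0 (suc x) (suc y)
  root≢ zero    _       ()
  root≢ (suc _) zero    ()
  root≢ (suc i) (suc j) eq with i Fin.≟ j
  root≢ (suc i) (suc j) () | yes _
  root≢ (suc i) (suc j) () | no _
Broom-isBinary (suc zero) _ _ _ (stem≼ {zero} , x≢) _ _ _ = contradiction ≡.refl x≢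
Broom-isBinary (suc zero) _ _ _ _ (stem≼ {zero} , y≢) _ _ = contradiction ≡.refl y≢
Broom-isBinary (suc zero) _ _ _ _ _ (stem≼ {zero} , z≢) _ = contradiction ≡.refl z≢
Broom-isBinary (suc zero) _ _ _ (refl≼ , x≢) _ _ _ = contradiction ≡.refl x≢
Broom-isBinary (suc zero) _ _ _ _ (refl≼ , y≢) _ _ = contradiction ≡.refl y≢
Broom-isBinary (suc zero) _ _ _ _ _ (refl≼ , z≢) _ = contradiction ≡.refl z≢
Broom-isBinary (suc zero) _ _ _ (stem≼ {suc x} , _) (stem≼ {suc y} , _) (stem≼ {suc z} , _) =
  two-leaves x y z
  where
  leaf : Fin 2 → Fin 4
  leaf i = suc (suc i)
  two-leaves : ∀ x y z → let _∧_ = _⋏_ 0 in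
    ¬ (suc zero ≡ leaf x ∧ leaf y × suc zero ≡ leaf x ∧ leaf z × suc zero ≡ leaf y ∧ leaf z)
  two-leaves zero       zero       _          (() , _ , _)
  two-leaves (suc zero) (suc zero) _          (() , _ , _)
  two-leaves zero       (suc zero) zero       (_ , () , _)
  two-leaves (suc zero) zero       (suc zero) (_ , () , _)
  two-leaves zero       (suc zero) (suc zero) (_ , _ , ())
  two-leaves (suc zero) zero       zero       (_ , _ , ())
Broom-isBinary (suc (suc _)) _ _ _ (refl≼ , x≢) _ _ _ = contradiction ≡.refl x≢

-- Fraïssé limits of classes of pseudotrees.

module FraïsséLimitProperties
  {K : Structure → Set} {M : Structure} (lim : IsFraïsséLimit K M)
  (K⇒isPseudotree : ∀ {A} → K A → IsPseudotree A)
  where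
  open Structure M
  open IsFraïsséLimit lim

  private
    -- Each pseudotree axiom can be verified inside a substructure generated by three elements. Such
    -- a substructure belongs to the age, hence to `K`, and so is a pseudotree.
    module Triple (x y z : Carrier) where
      gens : List Carrier
      gens = x ∷ y ∷ z ∷ []

      S : Substructure M
      S = record
        { Member = Generated M gens
        ; resp   = λ { x≈y (gen x∈) → gen (∈-resp x≈y x∈)
                     ; x≈y (meet p q e) → meet p q (trans (sym x≈y) e) }
        ; closed = λ p q → meet p q refl
        }
        where
        open import Data.List.Membership.Setoid setoid using (_∈_)
        ∈-resp : ∀ {a b} → a ≈ b → a ∈ gens → b ∈ gens
        ∈-resp e (here p)                 = here (trans (sym e) p)
        ∈-resp e (there (here p))         = there (here (trans (sym e) p))
        ∈-resp e (there (there (here p))) = there (there (here (trans (sym e) p)))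

      x′ y′ z′ : ∣ structure S ∣
      x′ = x , gen (here refl)
      y′ = y , gen (there (here refl))
      z′ = z , gen (there (there (here refl)))

      generated : ∀ a (p : Generated M gens a) →
                  Generated (structure S) (x′ ∷ y′ ∷ z′ ∷ []) (a , p)
      generated a (gen (here p))                 = gen (here p)
      generated a (gen (there (here p)))         = gen (there (here p))
      generated a (gen (there (there (here p)))) = gen (there (there (here p)))
      generated a (meet p q e)                   = meet (generated _ p) (generated _ q) e

      S↪M : structure S ↪ M
      S↪M = record
        { to = proj₁
        ; isOrderMonomorphism = record
          { isOrderHomomorphism = record { cong = λ e → e ; mono = λ l → l }
          ; injective = λ e → e
          ; cancel    = λ l → l
          }
        ; ∧-homo = λ _ _ → refl
        }

      S-isPseudotree : IsPseudotree (structure S)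
      S-isPseudotree = K⇒isPseudotree
        (Equivalence.to (age (structure S)) ((x′ ∷ y′ ∷ z′ ∷ [] , λ (a , p) → generated a p) , S↪M))

      open PseudotreeProperties S-isPseudotree public

  M-isPseudotree : IsPseudotree M
  M-isPseudotree = record
    { isPartialOrder = record
      { isPreorder = record
        { isEquivalence = isEquivalence
        ; reflexive     = λ {x} {y} → let open Triple x y y in ≤-reflexive {x′} {y′}
        ; trans         = λ {x} {y} {z} → let open Triple x y z in ≤-trans {x′} {y′} {z′}
        }
      ; antisym = λ {x} {y} → let open Triple x y y in antisym {x′} {y′}
      }
    ; ∧-sup = λ x y →
        (λ {z} (p , q) → let open Triple x y z in ∧-greatest {x′} {y′} {z′} p q) ,
        -- The bound `u` is tested at `x ∧ y`, itself a common lower bound, so `u` does not have to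
        -- be among the generators.
        λ u ub → let open Triple x y y in ub (x∧y≤x x′ y′ , x∧y≤y x′ y′)
    ; down-linear = λ a {x} {y} → let open Triple a x y in down-linear x′ {y′} {z′}
    }

  open PseudotreeProperties M-isPseudotree

  -- Any two such chains are isomorphic finitely generated substructures, so ultrahomogeneity
  -- applies. A broom embedded once can thereby be moved to any prescribed place.
  chains-homogeneous : ∀ {a b a′ b′} → a < b → a′ < b′ →
    Σ[ g ∈ M ≅ M ] (_≅_.to g a ≈ a′ × _≅_.to g b ≈ b′)
  chains-homogeneous {a} {b} a<b a′<b′ =
    let g , g≈ = ultrahomogeneous (imageSub i) (imageSub i′) finGen (image-≅ i i′)
    in g , g≈ (a , false , refl) , g≈ (b , true , refl)
    where
    i  = chain-↪ M-isPseudotree a<b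
    i′ = chain-↪ M-isPseudotree a′<b′
    finGen : FinitelyGenerated (structure (imageSub i))
    finGen = (a , false , refl) ∷ (b , true , refl) ∷ [] ,
             λ { (_ , false , p) → gen (here (sym p)) ; (_ , true , p) → gen (there (here (sym p))) }

  K⇒↪ : ∀ {A} → K A → A ↪ M
  K⇒↪ {A} k = proj₂ (Equivalence.from (age A) k)

  module _ {n : ℕ} (K-Broom : K (Broom n)) where
    private
      module B = Structure (Broom n)
      module m = _↪_ (K⇒↪ K-Broom)

      stem : ∣ Broom n ∣
      stem = suc zero
      leaf : Fin (2 ℕ.+ n) → ∣ Broom n ∣
      leaf i = suc (suc i)

      root<stem : zero B.< stem
      root<stem = root≼ , λ ()
      root<leaf : ∀ i → zero B.< leaf i
      root<leaf i = root≼ , λ ()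
      stem<leaf : ∀ i → stem B.< leaf i
      stem<leaf i = stem≼ , λ ()

      m-< : ∀ {x y} → x B.< y → m.to x < m.to y
      m-< = strict-mono (K⇒↪ K-Broom)

      leaf∧leaf : ∀ {i j} → i ≢ j → m.to (leaf i) ∧ m.to (leaf j) ≈ m.to stem
      leaf∧leaf {i} {j} i≢j = trans (sym (m.∧-homo (leaf i) (leaf j)))
                                    (m.cong (if-no (i Fin.≟ j) i≢j))

      module Move (g : M ≅ M) where
        module g = _≅_ g

        g-< : ∀ {x y} → x < y → g.to x < g.to y
        g-< (x≤y , x≉y) = g.mono x≤y , λ e → x≉y (g.injective e)

        g-∧ : ∀ {x y z} → x ∧ y ≈ z → g.to x ∧ g.to y ≈ g.to z
        g-∧ e = trans (sym (g.∧-homo _ _)) (g.cong e)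

    <-resp : ∀ {x x′ y y′} → x ≈ x′ → y ≈ y′ → x < y → x′ < y′
    <-resp p q (x≤y , x≉y) =
      proj₁ ≤-resp-≈ q (proj₂ ≤-resp-≈ p x≤y) , λ e → x≉y (trans p (trans e (sym q)))

    -- An automorphism takes the stem to `c` and the first leaf to `v`; the other `suc n` leaves
    -- become the fan.
    fan : ∀ {c v} → c < v →
      Σ[ b ∈ (Fin (suc n) → Carrier) ] (∀ i → c < b i × v ∧ b i ≈ c) ×
                                       (∀ {i j} → i ≢ j → b i ∧ b j ≈ c)
    fan c<v with g , gc , gv ← chains-homogeneous (m-< (stem<leaf zero)) c<v =
        (λ i → g.to (m.to (leaf (suc i))))
      , (λ i → <-resp gc refl (g-< (m-< (stem<leaf (suc i))))
             , trans (∧-cong (sym gv) refl) (trans (g-∧ (leaf∧leaf (λ ()))) gc))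
      , λ i≢j → trans (g-∧ (leaf∧leaf (λ eq → i≢j (Fin.suc-injective eq)))) gc
      where open Move g

    isRich : IsRich M
    isRich = record
      { bottom     = m.to zero
      ; top        = m.to stem
      ; bottom<top = m-< root<stem
      ; between    = between
      ; split      = λ c<v → let (b , splits , _) = fan c<v in b zero , splits zero
      }
      where
      between : ∀ {u v} → u < v → ∃ λ w → u < w × w < v
      -- The root and a leaf are moved to `u` and `v`; the stem lands between them.
      between u<v with g , gu , gv ← chains-homogeneous (m-< (root<leaf zero)) u<v =
          g.to (m.to stem)
        , <-resp gu refl (g-< (m-< root<stem))
        , <-resp refl gv (g-< (m-< (stem<leaf zero)))
        where open Move g

  hasFans : (∀ n → K (Broom n)) → HasFans M
  hasFans K-Broom c<v zero    = (λ ()) , (λ ()) , λ { {()} }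
  hasFans K-Broom c<v (suc n) = fan (K-Broom n) c<v

-- The colouring of chains by comparison of indices.

module ChainColouring {B : Structure} (isPseudotree : IsPseudotree B) (countable : Countable B) where
  open Structure B
  open PseudotreeProperties isPseudotree hiding (_splits_at_)
  open RightInverse countable
    renaming (to to index; from to element; to-cong to index-cong; strictlyInverseʳ to element-index)

  index-injective : ∀ {x y} → index x ≡ index y → x ≈ y
  index-injective {x} {y} eq =
    trans (sym (element-index x)) (trans (reflexive (≡.cong element eq)) (element-index y))

  -- Injectivity of `index` decides `_≈_`, and `x ≤ y` amounts to `x ∧ y ≈ x`.
  _≤?_ : Decidable₂ _≤_
  x ≤? y = map′ (λ eq → ≤-trans (≤-reflexive (sym (index-injective eq))) (x∧y≤y x y))
                (λ x≤y → index-cong (x≤y⇒x∧y≈x x≤y))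
                (index (x ∧ y) ℕ.≟ index x)

  abstract
    least-cover : ∀ a → ∃ (Least λ n → a ≤ element n)
    least-cover a = least (λ n → a ≤? element n) (index a) (≤-reflexive (sym (element-index a)))

  -- The enumeration `element` may have repetitions. `cover a` is the first position of the apex,
  -- possibly smaller than its `index`; equality of covers expresses equality of apexes.
  cover : ∣ B ∣ → ℕ
  cover a = proj₁ (least-cover a)

  apex : ∣ B ∣ → ∣ B ∣
  apex a = element (cover a)

  a≤apex : ∀ a → a ≤ apex a
  a≤apex a = proj₁ (proj₂ (least-cover a))

  cover-mono : ∀ {a b} → a ≤ b → cover a ℕ.≤ cover b
  cover-mono a≤b = proj₂ (proj₂ (least-cover _)) (≤-trans a≤b (a≤apex _))

  cover≤index : ∀ a → cover a ℕ.≤ index a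
  cover≤index a = proj₂ (proj₂ (least-cover a)) (≤-reflexive (sym (element-index a)))

  -- For c < b, the elements in the cone of b above c; everything when b ≤ c.
  InCone : (c b : ∣ B ∣) → ℕ → Set
  InCone c b n = element n ∧ b ≤ c → b ≤ c

  self-inCone : ∀ c b → InCone c b (index b)
  self-inCone c b =
    ≤-trans (∧-greatest (≤-reflexive (sym (element-index b))) ≤-refl)

  abstract
    least-birth : ∀ c b → ∃ (Least (InCone c b))
    least-birth c b = least (λ n → ((element n ∧ b) ≤? c) →-dec (b ≤? c)) (index b) (self-inCone c b)

  birth : ∣ B ∣ → ∣ B ∣ → ℕ
  birth c b = proj₁ (least-birth c b)

  birth-≤ : ∀ {c b n} → InCone c b n → birth c b ℕ.≤ n
  birth-≤ {c} {b} = proj₂ (proj₂ (least-birth c b))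

  cone : ∀ {c b} → c < b → ¬ element (birth c b) ∧ b ≤ c
  cone {c} {b} c<b le = <⇒≱ c<b (proj₁ (proj₂ (least-birth c b)) le)

  -- The colour peculiar to ψω is numbered last, so that the first seven are those of ψ₂.
  code : (coverᵃ coverᵇ indexᵃ indexᵇ indexᶜ birthᵇ : ℕ) → ℕ
  code ca cb ia ib ic β =
    if does (ca ℕ.≟ cb) then
      (if does (ia ℕ.<? ib) then 0 else 1)
    else if does (ic ℕ.≟ ia) then 2
    else if does (ia ℕ.<? ic) then 3
    else if does (ia ℕ.<? β) then 7
    else if does (ia ℕ.<? cb) then 4
    else if does (ia ℕ.<? ib) then 5
    else 6

  branch : ∣ B ∣ → ∣ B ∣ → ∣ B ∣
  branch a b = apex a ∧ b

  pairColour : ∣ B ∣ → ∣ B ∣ → ℕ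
  pairColour a b =
    code (cover a) (cover b) (index a) (index b) (index (branch a b)) (birth (branch a b) b)

  cover-cong : ∀ {a a′} → a ≈ a′ → cover a ≡ cover a′
  cover-cong eq = ℕ.≤-antisym (cover-mono (≤-reflexive eq)) (cover-mono (≤-reflexive (sym eq)))

  birth-cong : ∀ {c c′ b b′} → c ≈ c′ → b ≈ b′ → birth c b ≡ birth c′ b′
  birth-cong c≈ b≈ = ℕ.≤-antisym (mono c≈ b≈) (mono (sym c≈) (sym b≈))
    where
    mono : ∀ {c c′ b b′} → c ≈ c′ → b ≈ b′ → birth c b ℕ.≤ birth c′ b′
    mono {c} {c′} {b} {b′} c≈ b≈ = birth-≤ λ le →
      shift (sym b≈) (sym c≈) (proj₁ (proj₂ (least-birth c′ b′)) (shift (∧-cong refl b≈) c≈ le))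
      where
      shift : ∀ {x x′ y y′} → x ≈ x′ → y ≈ y′ → x ≤ y → x′ ≤ y′
      shift p q l = ≤-trans (≤-reflexive (sym p)) (≤-trans l (≤-reflexive q))

  branch-cong : ∀ {a a′ b b′} → a ≈ a′ → b ≈ b′ → branch a b ≈ branch a′ b′
  branch-cong a≈ b≈ = ∧-cong (reflexive (≡.cong element (cover-cong a≈))) b≈

  pairColour-cong : ∀ {a a′ b b′} → a ≈ a′ → b ≈ b′ → pairColour a b ≡ pairColour a′ b′
  pairColour-cong a≈ b≈ =
    code-cong (cover-cong a≈) (cover-cong b≈) (index-cong a≈) (index-cong b≈)
              (index-cong (branch-cong a≈ b≈)) (birth-cong (branch-cong a≈ b≈) b≈)
    where
    code-cong : ∀ {ca ca′ cb cb′ ia ia′ ib ib′ ic ic′ β β′} →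
      ca ≡ ca′ → cb ≡ cb′ → ia ≡ ia′ → ib ≡ ib′ → ic ≡ ic′ → β ≡ β′ →
      code ca cb ia ib ic β ≡ code ca′ cb′ ia′ ib′ ic′ β′
    code-cong ≡.refl ≡.refl ≡.refl ≡.refl ≡.refl ≡.refl = ≡.refl

  bottom top : Copy Chain B → ∣ B ∣
  bottom D = _↪_.to (copy-↪ D) false
  top    D = _↪_.to (copy-↪ D) true

  bottom-≤ : ∀ (D : Copy Chain B) {z} → ⟨ D ⟩ z → bottom D ≤ z
  bottom-≤ D {z} z∈ = let k , eq = iso.surjective (z , z∈) in
    ≤-trans (iso.mono (≤-minimum k)) (≤-reflexive (eq ≡.refl))
    where module iso = _≅_ (Copy.iso D)

  top-≥ : ∀ (D : Copy Chain B) {z} → ⟨ D ⟩ z → z ≤ top D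
  top-≥ D {z} z∈ = let k , eq = iso.surjective (z , z∈) in
    ≤-trans (≤-reflexive (sym (eq ≡.refl))) (iso.mono (≤-maximum k))
    where module iso = _≅_ (Copy.iso D)

  copyColour : Copy Chain B → ℕ
  copyColour D = pairColour (bottom D) (top D)

  -- The endpoints are the least and the greatest member of the copy, so they depend on the set
  -- alone and not on the chosen isomorphism.
  copyColour-cong : ∀ {D E} → ⟨ D ⟩ ≐ ⟨ E ⟩ → copyColour D ≡ copyColour E
  copyColour-cong {D} {E} (D⊆E , E⊆D) = pairColour-cong
    (antisym (bottom-≤ D (E⊆D (∈-copy E false))) (bottom-≤ E (D⊆E (∈-copy D false))))
    (antisym (top-≥ E (D⊆E (∈-copy D true))) (top-≥ D (E⊆D (∈-copy E true))))
    where
    ∈-copy : ∀ (F : Copy Chain B) k → ⟨ F ⟩ (_↪_.to (copy-↪ F) k)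
    ∈-copy F k = proj₂ (_≅_.to (Copy.iso F) k)

  -- Colours ℓ, ℓ + 1, … are identified.
  truncated : ∀ ℓ → Colouring Chain B (suc ℓ)
  truncated ℓ = record
    { to   = λ D → fromℕ< (s≤s (ℕ.m⊓n≤n (copyColour D) ℓ))
    ; cong = λ {D} {E} D≐E → Fin.fromℕ<-cong _ _ (≡.cong (_⊓ ℓ) (copyColour-cong {D} {E} D≐E)) _ _
    }

  Attained : ∀ {T} → T ↪ B → ℕ → Set
  Attained {T} φ k = ∃₂ λ a b → Structure._<_ T a b × pairColour (_↪_.to φ a) (_↪_.to φ b) ≡ k

  -- If `ℓ < p`, every `k ≤ ℓ` is attained in every copy, and truncation at `ℓ` fixes such a `k`.
  -- The truncated colouring then omits nothing, against the arrow.
  persistent⇒≤ : ∀ {p ℓ} → (∀ (φ : B ↪ B) {k} → k ℕ.< p → Attained φ k) →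
                 B ⟶⟨ Chain ⟩ suc ℓ → p ℕ.≤ ℓ
  persistent⇒≤ {p} {ℓ} persistent arrow = ℕ.≮⇒≥ λ ℓ<p →
    let C , omits = arrow (truncated ℓ) in omits ((λ _ → tt) , λ {k} _ → hit C ℓ<p k)
    where
    hit : ∀ (C : Copy B B) → ℓ ℕ.< p → ∀ k → image (truncated ℓ) C k
    hit C ℓ<p k =
        record { sub = imageSub chain ; iso = image-iso chain }
      , (λ { (false , e) → Substructure.resp (Copy.sub C) e (proj₂ (_≅_.to (Copy.iso C) a))
           ; (true  , e) → Substructure.resp (Copy.sub C) e (proj₂ (_≅_.to (Copy.iso C) b)) })
      , Fin.toℕ-injective (≡.trans (Fin.toℕ-fromℕ< _)
          (≡.trans (≡.cong (_⊓ ℓ) eq) (ℕ.m≤n⇒m⊓n≡m (Fin.toℕ≤pred[n] k))))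
      where
      attained = persistent (copy-↪ C) (ℕ.≤-<-trans (Fin.toℕ≤pred[n] k) ℓ<p)
      a = proj₁ attained
      b = proj₁ (proj₂ attained)
      eq = proj₂ (proj₂ (proj₂ attained))
      chain = chain-↪ isPseudotree (strict-mono (copy-↪ C) (proj₁ (proj₂ (proj₂ attained))))

  -- Attaining each colour under an arbitrary embedding.

  module Persistence
    {T : Structure} (T-isPseudotree : IsPseudotree T) (rich : IsRich T) (φ : T ↪ B)
    where
    private
      module T where
        open Structure T public
        open PseudotreeProperties T-isPseudotree public
        open IsRich rich public
      module φ = _↪_ φ
    open T using (_splits_at_)

    φ-< : ∀ {x y} → x T.< y → φ.to x < φ.to y
    φ-< = strict-mono φ

    φ-∧ : ∀ {x y z} → x T.∧ y T.≈ z → φ.to x ∧ φ.to y ≈ φ.to z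
    φ-∧ e = trans (sym (φ.∧-homo _ _)) (φ.cong e)

    φ-≰ : ∀ {x y} → ¬ x T.≤ y → ¬ φ.to x ≤ φ.to y
    φ-≰ x≰y le = x≰y (φ.cancel le)

    ascend : ∀ {u v} → u T.< v → ℕ → ∃ λ w → u T.< w × w T.< v
    ascend u<v zero    = T.between u<v
    ascend u<v (suc n) with w , u<w , w<v ← ascend u<v n
                       with w′ , w<w′ , w′<v ← T.between w<v
      = w′ , T.<-trans u<w w<w′ , w′<v

    ascend-step : ∀ {u v} (u<v : u T.< v) n → proj₁ (ascend u<v n) T.< proj₁ (ascend u<v (suc n))
    ascend-step u<v n with w , u<w , w<v ← ascend u<v n = proj₁ (proj₂ (T.between w<v))

    ascend-mono : ∀ {u v} (u<v : u T.< v) {i j} → i ℕ.< j →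
                  proj₁ (ascend u<v i) T.< proj₁ (ascend u<v j)
    ascend-mono u<v {i} {suc j} (s≤s i≤j) with ℕ.m≤n⇒m<n∨m≡n i≤j
    ... | inj₁ i<j    = T.<-trans (ascend-mono u<v i<j) (ascend-step u<v j)
    ... | inj₂ ≡.refl = ascend-step u<v j

    -- Density yields an infinite ascending sequence below `v`, along which indices are pairwise
    -- distinct.
    late-between : ∀ {u v} → u T.< v → ∀ N → ∃ λ w → u T.< w × w T.< v × N ℕ.< index (φ.to w)
    late-between u<v N =
      let i , late = injective-exceeds N (λ i → index (φ.to (proj₁ (ascend u<v (toℕ i)))))
            (λ i<j eq → proj₂ (ascend-mono u<v i<j) (φ.injective (index-injective eq)))
          w , u<w , w<v = ascend u<v (toℕ i)
      in w , u<w , w<v , late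

    -- All members of an ascending sequence below `top` have covers at most that of `top`, so two of
    -- them agree.
    equal-covers : ∃₂ λ u v → u T.< v × cover (φ.to u) ≡ cover (φ.to v)
    equal-covers =
      let i , j , i<j , eq = bounded-collision (cover (φ.to T.top)) (λ i → cover (φ.to (w i)))
            (λ i → cover-mono (φ.mono (proj₁ (proj₂ (proj₂ (ascend T.bottom<top (toℕ i)))))))
      in w i , w j , ascend-mono T.bottom<top i<j , eq
      where
      w : Fin (2 ℕ.+ cover (φ.to T.top)) → ∣ T ∣
      w i = proj₁ (ascend T.bottom<top (toℕ i))

    -- Elements with equal covers lie below a common apex, hence are comparable; so
    -- covers are unbounded on an infinite antichain.
    late-cover : ∀ {c b} → c T.< b → ∀ N → ∃₂ λ w b′ →
                 c T.< w × w T.< b × b′ splits b at w × N ℕ.< cover (φ.to b′)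
    late-cover {c} {b} c<b N =
      let i , late = injective-exceeds N (λ i → cover (φ.to (side (toℕ i)))) distinct
      in _ , _ , proj₁ (proj₂ (ascend c<b (toℕ i))) , w<b (toℕ i) , side-splits (toℕ i) , late
      where
      w : ℕ → ∣ T ∣
      w i = proj₁ (ascend c<b i)

      w<b : ∀ i → w i T.< b
      w<b i = proj₂ (proj₂ (ascend c<b i))

      side : ℕ → ∣ T ∣
      side i = proj₁ (T.split (w<b i))

      side-splits : ∀ i → side i splits b at w i
      side-splits i = proj₂ (T.split (w<b i))

      -- `w j ≤ side i` would put `w j` below `b ∧ side i ≈ w i`, though `w i < w j`. If
      -- `side i ≤ side j`, then `side i` is comparable with `w j`: either that case recurs, or
      -- `side i ≤ w j ≤ b`, against the splitting.
      incomparable : ∀ {i j} → i ℕ.< j → ¬ side j T.≤ side i × ¬ side i T.≤ side j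
      incomparable {i} {j} i<j = wⱼ≰ ∘ T.≤-trans wⱼ≤ , ≰
        where
        wᵢ<wⱼ = ascend-mono c<b i<j
        wⱼ≤ : w j T.≤ side j
        wⱼ≤ = proj₁ (proj₁ (side-splits j))
        wⱼ≰ : ¬ w j T.≤ side i
        wⱼ≰ le = T.<⇒≱ wᵢ<wⱼ (T.≤-trans (T.∧-greatest (proj₁ (w<b j)) le)
                                         (T.≤-reflexive (proj₂ (side-splits i))))
        ≰ : ¬ side i T.≤ side j
        ≰ le with T.down-linear (side j) le wⱼ≤
        ... | inj₁ sideᵢ≤wⱼ = T.splits⇒≰ (side-splits i) (T.≤-trans sideᵢ≤wⱼ (proj₁ (w<b j)))
        ... | inj₂ wⱼ≤sideᵢ = wⱼ≰ wⱼ≤sideᵢ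

      distinct : ∀ {i j} → i Fin.< j →
                 cover (φ.to (side (toℕ i))) ≢ cover (φ.to (side (toℕ j)))
      distinct {i} {j} i<j eq =
        [ φ-≰ (proj₂ (incomparable i<j)) , φ-≰ (proj₁ (incomparable i<j)) ]′
          (down-linear (apex (φ.to (side (toℕ i)))) (a≤apex _)
            (≡.subst (λ n → φ.to (side (toℕ j)) ≤ element n) (≡.sym eq) (a≤apex _)))

    -- One choice serves all colours: 0 to 3 start from `u < v` alone, while 4 to 7 keep `a` and `c`
    -- fixed and vary `b`.
    record Configuration : Set where
      field
        {u a c v b₀}      : ∣ T ∣
        u<a               : u T.< a
        a<c               : a T.< c
        c<v               : c T.< v
        b₀-splits         : b₀ splits v at c
        cover-u≡cover-v   : cover (φ.to u) ≡ cover (φ.to v)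
        c-before-a        : index (φ.to c) ℕ.< index (φ.to a)
        b₀-before-a       : index (φ.to b₀) ℕ.< index (φ.to a)

      u<c : u T.< c
      u<c = T.<-trans u<a a<c

      u<v : u T.< v
      u<v = T.<-trans u<c c<v

    configuration : Configuration
    configuration =
      let u , v , u<v , cover-u≡cover-v = equal-covers
          c , u<c , c<v = T.between u<v
          b₀ , b₀-splits = T.split c<v
          -- `a` is chosen last, so that its index can exceed those of both `c` and `b₀`.
          a , u<a , a<c , late = late-between u<c (index (φ.to c) ⊔ index (φ.to b₀))
      in record
        { u<a = u<a ; a<c = a<c ; c<v = c<v ; b₀-splits = b₀-splits
        ; cover-u≡cover-v = cover-u≡cover-v
        ; c-before-a  = ℕ.m⊔n<o⇒m<o (index (φ.to c)) _ late
        ; b₀-before-a = ℕ.m⊔n<o⇒n<o (index (φ.to c)) _ late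
        }

    module Realised (conf : Configuration) where
      open Configuration conf

      cover-const : ∀ {w} → u T.≤ w → w T.≤ v → cover (φ.to w) ≡ cover (φ.to v)
      cover-const u≤w w≤v = ℕ.≤-antisym (cover-mono (φ.mono w≤v))
        (≡.subst (ℕ._≤ cover _) cover-u≡cover-v (cover-mono (φ.mono u≤w)))

      unbranched : ∀ {a b} → u T.≤ a → a T.≤ b → b T.≤ v → cover (φ.to a) ≡ cover (φ.to b)
      unbranched u≤a a≤b b≤v = ≡.trans (cover-const u≤a (T.≤-trans a≤b b≤v))
                                       (≡.sym (cover-const (T.≤-trans u≤a a≤b) b≤v))

      -- The apex of `a` lies above `v`, and `v` is not below `b`; hence `b` leaves the apex exactly
      -- where it leaves `v`, namely at `c`. Equal covers would put `v` and `b` below one apex and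
      -- make them comparable.
      module Branching {a c b} (u≤a : u T.≤ a) (a≤c : a T.≤ c) (c<v : c T.< v)
                       (splits : b splits v at c) where
        v≤apex : φ.to v ≤ apex (φ.to a)
        v≤apex = ≡.subst (λ n → φ.to v ≤ element n)
          (≡.sym (cover-const u≤a (T.≤-trans a≤c (proj₁ c<v)))) (a≤apex _)

        cover≢ : cover (φ.to a) ≢ cover (φ.to b)
        cover≢ eq = [ φ-≰ (T.splits⇒≱ c<v splits) , φ-≰ (T.splits⇒≰ splits) ]′
          (down-linear (apex (φ.to a))
            v≤apex (≡.subst (λ n → φ.to b ≤ element n) (≡.sym eq) (a≤apex _)))

        branch≈ : branch (φ.to a) (φ.to b) ≈ φ.to c
        branch≈ = trans (∧-extendˡ (φ-≰ (T.splits⇒≱ c<v splits)) v≤apex) (φ-∧ (proj₂ splits))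

        index-branch : index (branch (φ.to a) (φ.to b)) ≡ index (φ.to c)
        index-branch = index-cong branch≈

        birth-branch : birth (branch (φ.to a) (φ.to b)) (φ.to b) ≡ birth (φ.to c) (φ.to b)
        birth-branch = birth-cong branch≈ refl

        a<b : a T.< b
        a<b = T.≤-trans a≤c (proj₁ (proj₁ splits)) ,
              λ a≈b → T.<⇒≱ (proj₁ splits) (T.≤-trans (T.≤-reflexive (T.sym a≈b)) a≤c)

      colour0 : Attained φ 0
      colour0 = let b , u<b , b<v , late = late-between u<v (index (φ.to u)) in u , b , u<b ,
        ≡.trans (if-yes (_ ℕ.≟ _) (unbranched T.≤-refl (proj₁ u<b) (proj₁ b<v))) (if-yes (_ ℕ.<? _) late)

      colour1 : Attained φ 1
      colour1 = let a , u<a , a<v , late = late-between u<v (index (φ.to v)) in a , v , a<v ,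
        ≡.trans (if-yes (_ ℕ.≟ _) (unbranched (proj₁ u<a) (proj₁ a<v) T.≤-refl))
                (if-no (_ ℕ.<? _) (ℕ.<-asym late))

      colour2 : Attained φ 2
      colour2 =
        -- Here the branching point is `u` itself, the lower end of the pair.
        let b , splits = T.split u<v
            open Branching T.≤-refl T.≤-refl u<v splits
        in u , b , a<b , ≡.trans (if-no (_ ℕ.≟ _) cover≢) (if-yes (_ ℕ.≟ _) index-branch)

      code-branching : ∀ {ca cb ia ib ic ic′ β β′} → ca ≢ cb → ic ≡ ic′ → β ≡ β′ → ic′ ≢ ia →
        code ca cb ia ib ic β ≡
        (if does (ia ℕ.<? ic′) then 3
         else if does (ia ℕ.<? β′) then 7
         else if does (ia ℕ.<? cb) then 4
         else if does (ia ℕ.<? ib) then 5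
         else 6)
      code-branching ca≢cb ≡.refl ≡.refl ic≢ia =
        ≡.trans (if-no (_ ℕ.≟ _) ca≢cb) (if-no (_ ℕ.≟ _) ic≢ia)

      colour3 : Attained φ 3
      colour3 =
        -- The branching point is taken late relative to the fixed `u`; any `b` leaving there will
        -- do.
        let c , u<c , c<v , late = late-between u<v (index (φ.to u))
            b , splits = T.split c<v
            open Branching T.≤-refl (proj₁ u<c) c<v splits
        in u , b , a<b ,
          ≡.trans (code-branching {ib = index (φ.to b)} cover≢ index-branch birth-branch (ℕ.>⇒≢ late))
                  (if-yes (_ ℕ.<? _) late)

      -- Since `b₀` and `b` meet strictly above `c`, `b₀` lies in the cone of `b`, and its index
      -- bounds the birth.
      born-by-b₀ : ∀ {b w} → c T.< w → b₀ T.∧ b T.≈ w → birth (φ.to c) (φ.to b) ℕ.≤ index (φ.to b₀)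
      born-by-b₀ {b} {w} c<w b₀∧b≈w = birth-≤ λ le → contradiction
        (≤-trans (≤-reflexive (sym (trans (∧-cong (element-index _) refl) (φ-∧ b₀∧b≈w)))) le)
        (<⇒≱ (φ-< c<w))

      -- `a` comes after `c` and after `b₀`, hence after the birth of the cone. This excludes
      -- colours 3 and 7 and leaves the comparisons with the cover and index of `b`.
      late-colour : ∀ {b w} → b splits v at c → c T.< w → b₀ T.∧ b T.≈ w →
        a T.< b × pairColour (φ.to a) (φ.to b) ≡
        (if does (index (φ.to a) ℕ.<? cover (φ.to b)) then 4
         else if does (index (φ.to a) ℕ.<? index (φ.to b)) then 5
         else 6)
      late-colour {b} splits c<w b₀∧b≈w = a<b ,
        ≡.trans (code-branching {ib = index (φ.to b)} cover≢ index-branch birth-branch (ℕ.<⇒≢ c-before-a))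
        (≡.trans (if-no (_ ℕ.<? _) (ℕ.<-asym c-before-a))
                 (if-no (_ ℕ.<? _) (ℕ.≤⇒≯ (ℕ.≤-trans (born-by-b₀ c<w b₀∧b≈w) (ℕ.<⇒≤ b₀-before-a)))))
        where open Branching (proj₁ u<a) (proj₁ a<c) c<v splits

      colour4 : Attained φ 4
      colour4 =
        -- `b` leaves `b₀` strictly above `c`: it stays in the cone of `b₀` but acquires a late
        -- apex.
        let w , b , c<w , w<b₀ , splits , late = late-cover (proj₁ b₀-splits) (index (φ.to a))
            w-splits = T.splits-within c<w (proj₁ w<b₀) b₀-splits
            a<b , eq = late-colour (T.splits-beyond w-splits (proj₁ (proj₁ splits))) c<w (proj₂ splits)
        in a , b , a<b , ≡.trans eq (if-yes (_ ℕ.<? _) late)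

      early-cover : ∀ {b} → b T.≤ b₀ → ¬ index (φ.to a) ℕ.< cover (φ.to b)
      early-cover b≤b₀ = ℕ.≤⇒≯
        (ℕ.≤-trans (cover-mono (φ.mono b≤b₀)) (ℕ.≤-trans (cover≤index _) (ℕ.<⇒≤ b₀-before-a)))

      colour5 : Attained φ 5
      colour5 =
        -- Below `b₀` the cover stays early while the index can be made late.
        let b , c<b , b<b₀ , late = late-between (proj₁ b₀-splits) (index (φ.to a))
            a<b , eq = late-colour (T.splits-within c<b (proj₁ b<b₀) b₀-splits) c<b
              (T.trans (T.∧-comm b₀ b) (T.x≤y⇒x∧y≈x (proj₁ b<b₀)))
        in a , b , a<b ,
          ≡.trans eq (≡.trans (if-no (_ ℕ.<? _) (early-cover (proj₁ b<b₀))) (if-yes (_ ℕ.<? _) late))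

      colour6 : Attained φ 6
      colour6 =
        -- For `b₀` itself both cover and index precede the index of `a`.
        let a<b , eq = late-colour b₀-splits (proj₁ b₀-splits) (T.x≤y⇒x∧y≈x T.≤-refl)
        in a , b₀ , a<b ,
          ≡.trans eq (≡.trans (if-no (_ ℕ.<? _) (early-cover T.≤-refl))
                              (if-no (_ ℕ.<? _) (ℕ.<-asym b₀-before-a)))

      -- An element lies in at most one cone of a fan, so births are unbounded along fans.
      late-birth : HasFans T → ∀ N → ∃ λ b → b splits v at c × N ℕ.< birth (φ.to c) (φ.to b)
      late-birth fans N =
        let b , splits , apart = fans c<v (2 ℕ.+ N)
            i , late = injective-exceeds N (λ i → birth (φ.to c) (φ.to (b i)))
              (λ {i} {j} i<j → disjoint (proj₁ (splits i)) (proj₁ (splits j)) (apart (Fin.<⇒≢ i<j)))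
        in b i , splits i , late
        where
        -- If one `y` represented both births, `y ∧ p` and `y ∧ q` would be comparable as elements
        -- below `y`. The smaller one lies below `p ∧ q ≈ c`, so `y` is outside one of the cones.
        disjoint : ∀ {p q} → c T.< p → c T.< q → p T.∧ q T.≈ c →
                   birth (φ.to c) (φ.to p) ≢ birth (φ.to c) (φ.to q)
        disjoint {p} {q} c<p c<q p∧q≈c eq =
          [ (λ le → cone (φ-< c<p) (below (x∧y≤y _ _) (≤-trans le (x∧y≤y _ _))))
          , (λ le → ¬y∧q≤c (below (≤-trans le (x∧y≤y _ _)) (x∧y≤y _ _)))
          ]′ (down-linear y (x∧y≤x y (φ.to p)) (x∧y≤x y (φ.to q)))
          where
          y = element (birth (φ.to c) (φ.to p))
          ¬y∧q≤c : ¬ y ∧ φ.to q ≤ φ.to c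
          ¬y∧q≤c = ≡.subst (λ n → ¬ element n ∧ φ.to q ≤ φ.to c) (≡.sym eq) (cone (φ-< c<q))
          below : ∀ {z} → z ≤ φ.to p → z ≤ φ.to q → z ≤ φ.to c
          below z≤p z≤q = ≤-trans (∧-greatest z≤p z≤q) (≤-reflexive (φ-∧ p∧q≈c))

      colour7 : HasFans T → Attained φ 7
      colour7 fans =
        let b , splits , late = late-birth fans (index (φ.to a))
            open Branching (proj₁ u<a) (proj₁ a<c) c<v splits
        in a , b , a<b ,
          ≡.trans (code-branching {ib = index (φ.to b)} cover≢ index-branch birth-branch (ℕ.<⇒≢ c-before-a))
          (≡.trans (if-no (_ ℕ.<? _) (ℕ.<-asym c-before-a)) (if-yes (_ ℕ.<? _) late))

      attained-<7 : ∀ {k} → k ℕ.< 7 → Attained φ k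
      attained-<7 {0} _ = colour0
      attained-<7 {1} _ = colour1
      attained-<7 {2} _ = colour2
      attained-<7 {3} _ = colour3
      attained-<7 {4} _ = colour4
      attained-<7 {5} _ = colour5
      attained-<7 {6} _ = colour6
      attained-<7 {suc (suc (suc (suc (suc (suc (suc _))))))}
        (s≤s (s≤s (s≤s (s≤s (s≤s (s≤s (s≤s ())))))))

      attained-<8 : HasFans T → ∀ {k} → k ℕ.< 8 → Attained φ k
      attained-<8 fans k<8 with ℕ.m≤n⇒m<n∨m≡n (ℕ.s≤s⁻¹ k<8)
      ... | inj₁ k<7    = attained-<7 k<7
      ... | inj₂ ≡.refl = colour7 fans

-- The lower bounds for both limits.

bigRamseyDegree-≥ : ∀ {B A p} → (∀ {ℓ} → B ⟶⟨ A ⟩ suc ℓ → p ℕ.≤ ℓ) →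
                    ∀ d → IsBigRamseyDegree B A d → [ p ] ≤⁺ d
bigRamseyDegree-≥ bound [ ℓ ] (arrow , _) = [ bound arrow ]
bigRamseyDegree-≥ bound ⊤⁺    _           = _ ≤⊤⁺

corollary9 : ((ψ₂ : Structure) → IsFraïsséLimit FiniteBinaryPseudotree ψ₂ →
    ∀ d → IsBigRamseyDegree ψ₂ Chain d → [ 7 ] ≤⁺ d)
    × ((ψω : Structure) → IsFraïsséLimit FinitePseudotree ψω →
    ∀ d → IsBigRamseyDegree ψω Chain d → [ 8 ] ≤⁺ d)
corollary9 = binary , general
  where
  binary : ∀ ψ₂ → IsFraïsséLimit FiniteBinaryPseudotree ψ₂ →
           ∀ d → IsBigRamseyDegree ψ₂ Chain d → [ 7 ] ≤⁺ d
  binary ψ₂ lim = bigRamseyDegree-≥ (persistent⇒≤ λ φ →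
    let open Persistence M-isPseudotree rich φ in Realised.attained-<7 configuration)
    where
    open FraïsséLimitProperties lim (λ (_ , isPseudotree , _) → isPseudotree)
    open ChainColouring M-isPseudotree (IsFraïsséLimit.countable lim)
    -- With parameter 0 the broom has just two leaves, as binarity demands.
    rich = isRich (Broom-finite 0 , Broom-isPseudotree 0 , Broom-isBinary)

  general : ∀ ψω → IsFraïsséLimit FinitePseudotree ψω →
            ∀ d → IsBigRamseyDegree ψω Chain d → [ 8 ] ≤⁺ d
  general ψω lim = bigRamseyDegree-≥
    (persistent⇒≤ λ φ → let open Persistence M-isPseudotree (isRich (K-Broom 0)) φ
                        in Realised.attained-<8 configuration (hasFans K-Broom))
    where
    open FraïsséLimitProperties lim proj₂
    open ChainColouring M-isPseudotree (IsFraïsséLimit.countable lim)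
    K-Broom : ∀ n → FinitePseudotree (Broom n)
    K-Broom n = Broom-finite n , Broom-isPseudotree n
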